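{- For every positive integer $k\leq 12$, there is no tournament $T$ having two distinct minimal $\tau$-retentive sets $R_1$ and $R_2$ with $|R_1|=3$ and $|R_2|=k$.
   Context: A tournament $T$ consists of a finite vertex set $V(T)$ and an asymmetric, complete binary relation $\succ$ on $V(T)$ ($x$ dominates $y$ if $x\succ y$). For $v\in V(T)$ let $N^-_T(v)=\{u\in V(T): u\succ v\}$; for $B\subseteq V(T)$, $T[B]$ is the induced subtournament. The tournament equilibrium set $\tau$ is defined recursively: a nonempty $A\subseteq V(T)$ is $\tau$-retentive if for every $v\in A$ with $N^-_T(v)\neq\emptyset$, $\tau(T[N^-_T(v)])\subseteq A$; $A$ is a minimal $\tau$-retentive set if no $\tau$-retentive set of $T$ is a proper subset of $A$; $\tau(T)$ is the union of all minimal $\tau$-retentive sets of $T$. -}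

module Defs where

open import Data.Nat using (ℕ; zero; suc)
open import Data.Bool using (Bool; T; _∧_)
open import Data.Fin using (Fin)
open import Data.Fin.Subset using (Subset; _∈_; _⊆_; _⊂_; Nonempty; ⊤)
open import Data.Vec using (tabulate; lookup)
open import Data.Product using (Σ; ∃; _×_)
open import Data.Sum using (_⊎_)
open import Data.Empty using (⊥)
open import Relation.Nullary using (¬_)
open import Relation.Binary.PropositionalEquality using (_≡_; _≢_)

record Tournament (n : ℕ) : Set where
  field
    beats    : Fin n → Fin n → Bool
    asym     : ∀ x y → T (beats x y) → ¬ T (beats y x)
    complete : ∀ x y → x ≢ y → T (beats x y) ⊎ T (beats y x)

module _ {n : ℕ} (Tr : Tournament n) where
  open Tournament Tr

  _≻_ : Fin n → Fin n → Set
  x ≻ y = T (beats x y)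

  inNbhd : Subset n → Fin n → Subset n
  inNbhd B v = tabulate (λ u → lookup B u ∧ beats u v)

  -- A is τ-retentive in T[B], where τ' describes τ of induced subtournaments
  -- (τ' C y : "y ∈ τ(T[C])").
  Retentive : (Subset n → Fin n → Set) → Subset n → Subset n → Set
  Retentive τ' B A =
    Nonempty A × A ⊆ B ×
    (∀ v → v ∈ A → Nonempty (inNbhd B v) → ∀ y → τ' (inNbhd B v) y → y ∈ A)

  MinRetentive : (Subset n → Fin n → Set) → Subset n → Subset n → Set
  MinRetentive τ' B A =
    Retentive τ' B A × (∀ A' → Retentive τ' B A' → ¬ (A' ⊂ A))

  -- inTau m B y : "y ∈ τ(T[B])", computed with fuel m; correct whenever ∣ B ∣ ≤ m
  -- (each recursive call is on an in-neighbourhood, which is strictly smaller).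
  inTau : ℕ → Subset n → Fin n → Set
  inTau zero    B y = ⊥
  inTau (suc m) B y = ∃ λ A → MinRetentive (inTau m) B A × y ∈ A

  MinimalTauRetentive : Subset n → Set
  MinimalTauRetentive A = MinRetentive (inTau n) ⊤ A

{-# OPTIONS --safe #-}

-- Minimal retentive sets R₁ ≢ R₂ are disjoint.  When ∣ R₁ ∣ ≤ 3, each a in R₁ has
-- a predecessor in R₁ that nobody beating a beats; following these predecessors
-- gives a 3-cycle in R₁ such that no vertex beats two of its members.  So every
-- v in R₂ is beaten by two of them, say a and b, while τ(N⁻(v)) ⊆ R₂.
--
-- Let C ⊆ R₂ be retentive in N⁻(v).  Every vertex of N⁻(v) outside C is beaten by
-- a member of C, and likewise for the retentive subsets of C in smaller in-neighbourhoods.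
-- If w, v′ ∈ C both beat b and w beats v′, applying this to w in N⁻(v′) yields
-- a member of C beating both; it beats b or is itself beaten by a member of C
-- beating b, so at least three members of C beat b.  Likewise three others beat a.
-- Hence all indegrees within R₂ are at least 6, which forces ∣ R₂ ∣ ≥ 13.
module Submission where

open import Defs
open import Data.Nat using (ℕ; _≤_)
open import Data.Fin.Subset using (Subset; ∣_∣)
open import Data.Empty using (⊥)
open import Relation.Binary.PropositionalEquality using (_≡_; _≢_)

import Algebra.Properties.Semiring.Sum
open import Data.Bool using (Bool; true; false; T; _∧_; if_then_else_)
open import Data.Bool.Properties using (T?; T-≡; T-∧; ∧-comm; ∧-assoc)
open import Data.Fin using (Fin; zero; suc; _≟_)
open import Data.Fin.Properties using (any?)
open import Data.Fin.Subset using (_∈_; _∉_; _⊆_; _⊂_; _∩_; _-_; Nonempty; ⊤)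
open import Data.Fin.Subset.Induction using (Acc; acc; ⊂-wellFounded)
open import Data.Fin.Subset.Properties using
  (_∈?_; ∈⊤; ∣p∣≤n; ⊆-antisym; p⊂q⇒∣p∣<∣q∣; p⊆q⇒∣p∣≤∣q∣; p∩q⊆p; p∩q⊆q; x∈p∩q⁺;
   x∈p∧x≢y⇒x∈p-y; x∈p⇒∣p-x∣<∣p∣)
open import Data.List using ([]; _∷_; length)
open import Data.List.Properties using (length-++)
open import Data.List.Relation.Unary.All as All using (All; []; _∷_)
open import Data.List.Relation.Unary.All.Properties using (++⁺)
open import Data.List.Relation.Unary.AllPairs using ([]; _∷_)
open import Data.List.Relation.Unary.Unique.Propositional using (Unique)
import Data.List.Relation.Unary.Unique.Propositional.Properties as Unique
open import Data.Nat using (zero; suc; _+_; _*_; _<_; _≤?_; z≤n; s≤s; s≤s⁻¹; >-nonZero)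
open import Data.Nat.Properties using
  (+-*-semiring; +-mono-≤; +-monoʳ-≤; *-comm; *-identityˡ;
   *-cancelʳ-≤; *-distribʳ-+; ≤-refl; ≤-reflexive; ≤-trans; <-≤-trans; ≤-<-trans;
   m≤n⇒m≤1+n; <⇒≱; n≮0; module ≤-Reasoning)
open import Data.Product using (∃; _×_; _,_; proj₁; proj₂)
open import Data.Sum using (_⊎_; inj₁; inj₂; [_,_]′)
open import Data.Vec using ([]; _∷_; lookup; tabulate)
open import Data.Vec.Properties using (lookup∘tabulate; []=⇒lookup; lookup⇒[]=)
open import Function using (_∘_; case_of_; Equivalence)
open import Relation.Binary.PropositionalEquality using (refl; sym; trans; cong; cong₂; subst)
open import Relation.Nullary using (¬_; Dec; yes; no; contradiction)
open import Relation.Nullary.Decidable using (decidable-stable; _×-dec_; _⊎-dec_)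

open Algebra.Properties.Semiring.Sum +-*-semiring
  using (sum-syntax; ∑-comm; ∑-distrib-+; sum-cong-≗; sum-replicate-zero; *-distribʳ-sum)

-- Cardinalities of subsets, as bounds on lists and as sums of indicators.

length≤∣_∣ : ∀ {n} (p : Subset n) {xs} → Unique xs → All (_∈ p) xs → length xs ≤ ∣ p ∣
length≤∣ p ∣ []         []           = z≤n
length≤∣ p ∣ (x∉xs ∷ u) (x∈p ∷ xs⊆p) = ≤-<-trans
  (length≤∣ p - _ ∣ u
    (All.zipWith (λ (x≢y , y∈p) → x∈p∧x≢y⇒x∈p-y y∈p (x≢y ∘ sym)) (x∉xs , xs⊆p)))
  (x∈p⇒∣p-x∣<∣p∣ x∈p)

⟦_⟧ : Bool → ℕ
⟦ b ⟧ = if b then 1 else 0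

∣p∣≡∑ : ∀ {n} (p : Subset n) → ∣ p ∣ ≡ ∑[ i < n ] ⟦ lookup p i ⟧
∣p∣≡∑ []          = refl
∣p∣≡∑ (true  ∷ p) = cong suc (∣p∣≡∑ p)
∣p∣≡∑ (false ∷ p) = ∣p∣≡∑ p

∣tabulate∣≡∑ : ∀ {n} (f : Fin n → Bool) → ∣ tabulate f ∣ ≡ ∑[ i < n ] ⟦ f i ⟧
∣tabulate∣≡∑ f =
  trans (∣p∣≡∑ (tabulate f)) (sum-cong-≗ (λ i → cong ⟦_⟧ (lookup∘tabulate f i)))

∑-mono-≤ : ∀ {n} {f g : Fin n → ℕ} → (∀ i → f i ≤ g i) → ∑[ i < n ] f i ≤ ∑[ i < n ] g i
∑-mono-≤ {zero}  f≤g = z≤n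
∑-mono-≤ {suc n} f≤g = +-mono-≤ (f≤g zero) (∑-mono-≤ (f≤g ∘ suc))

∈⇒T : ∀ {n} {p : Subset n} {x} → x ∈ p → T (lookup p x)
∈⇒T = Equivalence.from T-≡ ∘ []=⇒lookup

T⇒∈ : ∀ {n} {p : Subset n} {x} → T (lookup p x) → x ∈ p
T⇒∈ {p = p} {x} = lookup⇒[]= x p ∘ Equivalence.to T-≡

-- Dominance, in-neighbourhoods and the degree count.

module _ {n : ℕ} (Tr : Tournament n) where
  open Tournament Tr

  infix 4 _▷_ _▷?_

  _▷_ : Fin n → Fin n → Set
  x ▷ y = T (beats x y)

  _▷?_ : ∀ x y → Dec (x ▷ y)
  x ▷? y = T? (beats x y)

  ▷-irrefl : ∀ {x y} → x ≡ y → ¬ x ▷ y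
  ▷-irrefl {x} refl x▷x = asym x x x▷x x▷x

  ▷⇒≢ : ∀ {x y} → x ▷ y → x ≢ y
  ▷⇒≢ x▷y x≡y = ▷-irrefl x≡y x▷y

  ▷-separates : ∀ {x w y} → x ▷ w → w ▷ y → x ≢ y
  ▷-separates {x} {w} x▷w w▷y refl = asym x w x▷w w▷y

  ⋫⇒▷ : ∀ {x y} → x ≢ y → ¬ x ▷ y → y ▷ x
  ⋫⇒▷ {x} {y} x≢y ¬x▷y = [ (λ x▷y → contradiction x▷y ¬x▷y) , (λ y▷x → y▷x) ]′ (complete x y x≢y)

  N⁻ : Subset n → Fin n → Subset n
  N⁻ = inNbhd Tr

  ∈-N⁻⁺ : ∀ {B u v} → u ∈ B → u ▷ v → u ∈ N⁻ B v
  ∈-N⁻⁺ {B} {u} {v} u∈B u▷v =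
    T⇒∈ (subst T (sym (lookup∘tabulate _ u)) (Equivalence.from T-∧ (∈⇒T u∈B , u▷v)))

  ∈-N⁻⁻ : ∀ B {u v} → u ∈ N⁻ B v → u ∈ B × u ▷ v
  ∈-N⁻⁻ B {u} {v} u∈N with Equivalence.to T-∧ (subst T (lookup∘tabulate _ u) (∈⇒T u∈N))
  ... | u∈B , u▷v = T⇒∈ {p = B} u∈B , u▷v

  N⁻⊂ : ∀ {B v} → v ∈ B → N⁻ B v ⊂ B
  N⁻⊂ {B} v∈B = proj₁ ∘ ∈-N⁻⁻ B , _ , v∈B , ▷-irrefl refl ∘ proj₂ ∘ ∈-N⁻⁻ B

  -- Within `R` the indegrees and the outdegrees have the same sum, at least `d * ∣ R ∣`, and at
  -- each vertex the two degrees plus 1 are at most `∣ R ∣`. Summing over `R` and cancelling `∣ R ∣`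
  -- gives the bound.
  2*min-indegree<∣R∣ : ∀ {d R} → Nonempty R → (∀ {v} → v ∈ R → d ≤ ∣ N⁻ R v ∣) → d + d < ∣ R ∣
  2*min-indegree<∣R∣ {d} {R} (x , x∈R) d≤N⁻ = *-cancelʳ-≤ _ _ ∣ R ∣ {{>-nonZero 0<∣R∣}} (begin
    suc (d + d) * ∣ R ∣                                                 ≡⟨ cong (∣ R ∣ +_) (*-distribʳ-+ ∣ R ∣ d d) ⟩
    ∣ R ∣ + (d * ∣ R ∣ + d * ∣ R ∣)                                     ≤⟨ +-monoʳ-≤ ∣ R ∣ (+-mono-≤ d*∣R∣≤ins (≤-trans d*∣R∣≤ins (≤-reflexive ins≡outs))) ⟩
    ∣ R ∣ + (ins + outs)                                                ≡⟨ cong (_+ (ins + outs)) (∣p∣≡∑ R) ⟩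
    (∑[ v < n ] χ v) + (ins + outs)                                     ≡⟨ cong ((∑[ v < n ] χ v) +_) (∑-distrib-+ in′ out′) ⟨
    (∑[ v < n ] χ v) + (∑[ v < n ] (in′ v + out′ v))                    ≡⟨ ∑-distrib-+ χ (λ v → in′ v + out′ v) ⟨
    ∑[ v < n ] (χ v + (in′ v + out′ v))                                 ≤⟨ ∑-mono-≤ degrees≤ ⟩
    ∑[ v < n ] (χ v * ∣ R ∣)                                            ≡⟨ *-distribʳ-sum ∣ R ∣ χ ⟨
    (∑[ v < n ] χ v) * ∣ R ∣                                            ≡⟨ cong (_* ∣ R ∣) (∣p∣≡∑ R) ⟨
    ∣ R ∣ * ∣ R ∣                                                       ∎)
    where
    open ≤-Reasoning

    χ : Fin n → ℕ
    χ v = ⟦ lookup R v ⟧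

    -- Both indicate an arc inside `R`. They test different endpoints first, so that splitting on
    -- membership of the vertex whose degree is taken reduces every summand of `in′` or `out′`.
    arc arc′ : Fin n → Fin n → Bool
    arc u v = lookup R v ∧ (lookup R u ∧ beats u v)
    arc′ u v = lookup R u ∧ (lookup R v ∧ beats u v)

    in′ out′ : Fin n → ℕ
    in′ v = ∑[ u < n ] ⟦ arc u v ⟧
    out′ u = ∑[ v < n ] ⟦ arc′ u v ⟧

    ins outs : ℕ
    ins = ∑[ v < n ] in′ v
    outs = ∑[ u < n ] out′ u

    0<∣R∣ : 0 < ∣ R ∣
    0<∣R∣ = ≤-<-trans z≤n (x∈p⇒∣p-x∣<∣p∣ x∈R)

    arc≡arc′ : ∀ u v → arc u v ≡ arc′ u v
    arc≡arc′ u v = trans (sym (∧-assoc (lookup R v) _ _))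
      (trans (cong (_∧ beats u v) (∧-comm (lookup R v) _)) (∧-assoc (lookup R u) _ _))

    ins≡outs : ins ≡ outs
    ins≡outs = trans (∑-comm (λ v u → ⟦ arc u v ⟧))
      (sum-cong-≗ (λ u → sum-cong-≗ (λ v → cong ⟦_⟧ (arc≡arc′ u v))))

    χ*d≤in′ : ∀ v → χ v * d ≤ in′ v
    χ*d≤in′ v with lookup R v in eq
    ... | false = z≤n
    ... | true  = begin
      1 * d       ≡⟨ *-identityˡ d ⟩
      d           ≤⟨ d≤N⁻ (lookup⇒[]= v R eq) ⟩
      ∣ N⁻ R v ∣  ≡⟨ ∣tabulate∣≡∑ (λ u → lookup R u ∧ beats u v) ⟩
      _           ∎

    d*∣R∣≤ins : d * ∣ R ∣ ≤ ins
    d*∣R∣≤ins = begin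
      d * ∣ R ∣               ≡⟨ *-comm d ∣ R ∣ ⟩
      ∣ R ∣ * d               ≡⟨ cong (_* d) (∣p∣≡∑ R) ⟩
      (∑[ v < n ] χ v) * d    ≡⟨ *-distribʳ-sum d χ ⟩
      ∑[ v < n ] (χ v * d)    ≤⟨ ∑-mono-≤ χ*d≤in′ ⟩
      ins                     ∎

    -- Asymmetry allows at most one of the two arcs, and `u ≡ v` allows neither, which is why `v`
    -- can be removed on the right.
    in+out≤ : ∀ {v} u → ⟦ lookup R u ∧ beats u v ⟧ + ⟦ lookup R u ∧ beats v u ⟧ ≤ ⟦ lookup (R - v) u ⟧
    in+out≤ {v} u with lookup R u in u∈R | beats u v in u▷v | beats v u in v▷u
    ... | false | _     | _     = z≤n
    ... | true  | false | false = z≤n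
    ... | true  | true  | true  =
      contradiction (Equivalence.from T-≡ v▷u) (asym u v (Equivalence.from T-≡ u▷v))
    ... | true  | true  | false rewrite []=⇒lookup (x∈p∧x≢y⇒x∈p-y
      (lookup⇒[]= u R u∈R) (▷⇒≢ (Equivalence.from T-≡ u▷v))) = ≤-refl
    ... | true  | false | true  rewrite []=⇒lookup (x∈p∧x≢y⇒x∈p-y
      (lookup⇒[]= u R u∈R) (▷⇒≢ (Equivalence.from T-≡ v▷u) ∘ sym)) = ≤-refl

    degrees≤ : ∀ v → χ v + (in′ v + out′ v) ≤ χ v * ∣ R ∣
    degrees≤ v with lookup R v in eq
    ... | false = ≤-reflexive (cong₂ _+_ (sum-replicate-zero n) (sum-replicate-zero n))
    ... | true  = begin
      suc ((∑[ u < n ] ⟦ lookup R u ∧ beats u v ⟧) + (∑[ u < n ] ⟦ lookup R u ∧ beats v u ⟧))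
        ≡⟨ cong suc (∑-distrib-+ (λ u → ⟦ lookup R u ∧ beats u v ⟧) _) ⟨
      suc (∑[ u < n ] (⟦ lookup R u ∧ beats u v ⟧ + ⟦ lookup R u ∧ beats v u ⟧))
        ≤⟨ s≤s (∑-mono-≤ in+out≤) ⟩
      suc (∑[ u < n ] ⟦ lookup (R - v) u ⟧)
        ≡⟨ cong suc (∣p∣≡∑ (R - v)) ⟨
      suc ∣ R - v ∣
        ≤⟨ x∈p⇒∣p-x∣<∣p∣ (lookup⇒[]= v R eq) ⟩
      ∣ R ∣
        ≡⟨ *-identityˡ ∣ R ∣ ⟨
      1 * ∣ R ∣ ∎

  -- Retentive sets and their descent into in-neighbourhoods.

  -- The bound on ∣ B ∣ guarantees that the fuel never runs out.
  record RetentiveIn (B C : Subset n) : Set where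
    constructor retentiveIn
    field
      {fuel}    : ℕ
      enough    : ∣ B ∣ ≤ suc fuel
      retentive : Retentive Tr (inTau Tr fuel) B C

    nonempty : Nonempty C
    nonempty = proj₁ retentive

    ⊆B : C ⊆ B
    ⊆B = proj₁ (proj₂ retentive)

  open RetentiveIn

  whole-retentive : ∀ m {B} → Nonempty B → Retentive Tr (inTau Tr m) B B
  whole-retentive m {B} B≢∅ = B≢∅ , (λ x∈B → x∈B) , λ v _ _ y → tau⊆ m
    where
    tau⊆ : ∀ m {v y} → inTau Tr m (N⁻ B v) y → y ∈ B
    tau⊆ (suc m) (A , ((_ , A⊆N , _) , _) , y∈A) = proj₁ (∈-N⁻⁻ B (A⊆N y∈A))

  -- Retentiveness is not decided here, so descent along `⊂` yields a minimal set only under double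
  -- negation. Later goals are decidable or empty, which discharges it.
  ¬¬minimal : ∀ τ′ {B A} → Retentive Tr τ′ B A → ¬ ¬ ∃ (MinRetentive Tr τ′ B)
  ¬¬minimal τ′ {B} {A} = go A (⊂-wellFounded A)
    where
    go : ∀ A → Acc _⊂_ A → Retentive Tr τ′ B A → ¬ ¬ ∃ (MinRetentive Tr τ′ B)
    go A (acc rec) retA ¬min = ¬min (A , retA , λ A′ retA′ A′⊂A → go A′ (rec A′⊂A) retA′ ¬min)

  -- A minimal retentive set of `N⁻ B v` is part of its τ, which lies in `C` by retentiveness; it
  -- serves as `C′`.
  descend : ∀ {B C v} → RetentiveIn B C → v ∈ C → Nonempty (N⁻ B v) →
    ¬ ¬ ∃ λ C′ → C′ ⊆ C × RetentiveIn (N⁻ B v) C′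
  descend {B} {C} {v} R@(retentiveIn {m} B≤ (_ , C⊆B , closed)) v∈C ne@(x , x∈N) none
    with m | closed | s≤s⁻¹ (<-≤-trans (p⊂q⇒∣p∣<∣q∣ (N⁻⊂ (C⊆B v∈C))) B≤)
  -- Without fuel for the recursive call, `N⁻ B v` would be empty, yet it contains `x`.
  ... | zero  | _      | N≤ = n≮0 (<-≤-trans (x∈p⇒∣p-x∣<∣p∣ x∈N) N≤)
  ... | suc m | closed | N≤ = ¬¬minimal (inTau Tr m) (whole-retentive m ne) λ (A , minA) →
    none (A , (λ y∈A → closed v v∈C ne _ (A , minA , y∈A)) , retentiveIn N≤ (proj₁ minA))

  -- If some `v ∈ C` neither is nor beats `a`, then `a` lies in `N⁻ B v`, and the argument repeats
  -- there with a retentive subset of `C`. In-neighbourhoods shrink, so this ends.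
  dominating : ∀ {B C a} → RetentiveIn B C → a ∈ B → ∃ λ w → w ∈ C × (w ≡ a ⊎ w ▷ a)
  dominating {B} {C} {a} R a∈B =
    decidable-stable (any? (λ w → (w ∈? C) ×-dec ((w ≟ a) ⊎-dec (w ▷? a)))) (go (⊂-wellFounded B) R a∈B)
    where
    go : ∀ {B C} → Acc _⊂_ B → RetentiveIn B C → a ∈ B → ¬ ¬ ∃ λ w → w ∈ C × (w ≡ a ⊎ w ▷ a)
    go {B} (acc rec) R a∈B none with nonempty R
    ... | v , v∈C = descend R v∈C (a , a∈N) λ (C′ , C′⊆C , R′) →
      go (rec (N⁻⊂ (⊆B R v∈C))) R′ a∈N λ (w , w∈C′ , w-dom) → none (w , C′⊆C w∈C′ , w-dom)
      where
      a∈N : a ∈ N⁻ B v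
      a∈N = ∈-N⁻⁺ a∈B (⋫⇒▷ (λ v≡a → none (v , v∈C , inj₁ v≡a)) (λ v▷a → none (v , v∈C , inj₂ v▷a)))

  -- This is `dominating` inside `N⁻ B v`, whose vertices all beat `v`.
  predecessor : ∀ {B C v a} → RetentiveIn B C → v ∈ C → a ∈ B → a ▷ v →
    ∃ λ w → w ∈ C × w ▷ v × (w ≡ a ⊎ w ▷ a)
  predecessor {B} {C} {v} {a} R v∈C a∈B a▷v =
    decidable-stable (any? (λ w → (w ∈? C) ×-dec ((w ▷? v) ×-dec ((w ≟ a) ⊎-dec (w ▷? a))))) λ none →
      descend R v∈C (a , ∈-N⁻⁺ a∈B a▷v) λ (C′ , C′⊆C , R′) →
        case dominating R′ (∈-N⁻⁺ a∈B a▷v) of λ (w , w∈C′ , w-dom) →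
        none (w , C′⊆C w∈C′ , proj₂ (∈-N⁻⁻ B (⊆B R′ w∈C′)) , w-dom)

  common-predecessor : ∀ {B C v w a} → RetentiveIn B C → v ∈ C → w ∈ C → w ▷ v →
    a ∈ B → a ▷ v → a ▷ w → ∃ λ z → z ∈ C × z ▷ v × z ▷ w
  common-predecessor {B} {C} {v} {w} {a} R v∈C w∈C w▷v a∈B a▷v a▷w =
    decidable-stable (any? (λ z → (z ∈? C) ×-dec ((z ▷? v) ×-dec (z ▷? w)))) λ none →
      descend R v∈C (w , w∈N) λ (C′ , C′⊆C , R′) →
        let found : ∀ {z} → z ∈ C′ → z ▷ w → ⊥
            found z∈C′ z▷w = none (_ , C′⊆C z∈C′ , proj₂ (∈-N⁻⁻ B (⊆B R′ z∈C′)) , z▷w)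
        in case dominating R′ w∈N of λ where
          (z , z∈C′ , inj₂ z▷w)  → found z∈C′ z▷w
          -- Here `w` itself lies in `C′`. Since `a` is a vertex of `N⁻ B v` beating `w`, some
          -- member of `C′` beats `w` too.
          (z , z∈C′ , inj₁ refl) →
            case predecessor R′ z∈C′ (∈-N⁻⁺ a∈B a▷v) a▷w of λ (y , y∈C′ , y▷w , _) → found y∈C′ y▷w
    where
    w∈N : w ∈ N⁻ B v
    w∈N = ∈-N⁻⁺ (⊆B R w∈C) w▷v

  -- Three members beating each of two outside vertices.

  -- Some `x` beats `b`, so `a` beats `x`; a predecessor `y` of `x` beats `a`, so `b` beats `y`; a
  -- predecessor `z` of `y` beats `b`. As `z ▷ y ▷ x`, the vertices `x` and `z` are distinct, and
  -- `third` extends this pair.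
  three-beating : ∀ {B C a b} → RetentiveIn B C → a ∈ B → b ∈ B → a ∉ C → b ∉ C →
    (∀ {u} → u ∈ C → ¬ (u ▷ a × u ▷ b)) →
    ∃ λ xs → length xs ≡ 3 × Unique xs × All (λ u → u ∈ C × u ▷ b) xs
  three-beating {B} {C} {a} {b} R a∈B b∈B a∉C b∉C ¬both = result
    where
    beaten : ∀ {u c} → u ∈ C → c ∉ C → ¬ u ▷ c → c ▷ u
    beaten u∈C c∉C = ⋫⇒▷ λ { refl → c∉C u∈C }

    proper : ∀ {w c} → c ∉ C → w ∈ C → (w ≡ c ⊎ w ▷ c) → w ▷ c
    proper c∉C w∈C (inj₁ refl) = contradiction w∈C c∉C
    proper c∉C w∈C (inj₂ w▷c)  = w▷c

    a▷ : ∀ {u} → u ∈ C → u ▷ b → a ▷ u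
    a▷ u∈C u▷b = beaten u∈C a∉C λ u▷a → ¬both u∈C (u▷a , u▷b)

    predecessor▷b : ∀ {u} → u ∈ C → ¬ u ▷ b → ∃ λ w → w ∈ C × w ▷ u × w ▷ b
    predecessor▷b u∈C ¬u▷b =
      case predecessor R u∈C b∈B (beaten u∈C b∉C ¬u▷b) of λ (w , w∈C , w▷u , w-dom) →
      w , w∈C , w▷u , proper b∉C w∈C w-dom

    -- As `a` beats both `v` and `w`, they have a common predecessor `z` in `C`. If `z` does not
    -- beat `b`, a predecessor of `z` that does replaces it, and is new because `z` beats `v` and
    -- `w`.
    third : ∀ {v w} → v ∈ C → w ∈ C → v ▷ b → w ▷ b → w ▷ v →
      ∃ λ xs → length xs ≡ 3 × Unique xs × All (λ u → u ∈ C × u ▷ b) xs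
    third {v} {w} v∈C w∈C v▷b w▷b w▷v
      with common-predecessor R v∈C w∈C w▷v a∈B (a▷ v∈C v▷b) (a▷ w∈C w▷b)
    ... | z , z∈C , z▷v , z▷w with z ▷? b
    ... | yes z▷b = z ∷ w ∷ v ∷ [] , refl
                  , (▷⇒≢ z▷w ∷ ▷⇒≢ z▷v ∷ []) ∷ (▷⇒≢ w▷v ∷ []) ∷ [] ∷ []
                  , (z∈C , z▷b) ∷ (w∈C , w▷b) ∷ (v∈C , v▷b) ∷ []
    ... | no ¬z▷b with predecessor▷b z∈C ¬z▷b
    ... | y , y∈C , y▷z , y▷b = y ∷ w ∷ v ∷ [] , refl
                  , (▷-separates y▷z z▷w ∷ ▷-separates y▷z z▷v ∷ []) ∷ (▷⇒≢ w▷v ∷ []) ∷ [] ∷ []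
                  , (y∈C , y▷b) ∷ (w∈C , w▷b) ∷ (v∈C , v▷b) ∷ []

    result : ∃ λ xs → length xs ≡ 3 × Unique xs × All (λ u → u ∈ C × u ▷ b) xs
    result with dominating R b∈B
    ... | x , x∈C , x-dom with proper b∉C x∈C x-dom
    ... | x▷b with predecessor R x∈C a∈B (a▷ x∈C x▷b)
    ... | y , y∈C , y▷x , y-dom with predecessor▷b y∈C (λ y▷b → ¬both y∈C (proper a∉C y∈C y-dom , y▷b))
    ... | z , z∈C , z▷y , z▷b with complete x z (▷-separates z▷y y▷x ∘ sym)
    ... | inj₁ x▷z = third z∈C x∈C z▷b x▷b x▷z
    ... | inj₂ z▷x = third x∈C z∈C x▷b z▷b z▷x

  -- Exchanging `a` and `b` gives a second triple, disjoint from the first because no member of `C`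
  -- beats both.
  6≤∣C∣ : ∀ {B C a b} → RetentiveIn B C → a ∈ B → b ∈ B → a ∉ C → b ∉ C →
    (∀ {u} → u ∈ C → ¬ (u ▷ a × u ▷ b)) → 6 ≤ ∣ C ∣
  6≤∣C∣ {C = C} R a∈B b∈B a∉C b∉C ¬both =
    case three-beating R a∈B b∈B a∉C b∉C ¬both of λ (xs , ∣xs∣≡3 , xs! , xs▷b) →
    case three-beating R b∈B a∈B b∉C a∉C (λ u∈C (u▷b , u▷a) → ¬both u∈C (u▷a , u▷b)) of
      λ (ys , ∣ys∣≡3 , ys! , ys▷a) →
    subst (_≤ ∣ C ∣) (trans (length-++ xs) (cong₂ _+_ ∣xs∣≡3 ∣ys∣≡3))
      (length≤∣ C ∣
        (Unique.++⁺ xs! ys! λ (u∈xs , u∈ys) →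
          let u∈C , u▷b = All.lookup xs▷b u∈xs
          in ¬both u∈C (proj₂ (All.lookup ys▷a u∈ys) , u▷b))
        (++⁺ (All.map proj₁ xs▷b) (All.map proj₁ ys▷a)))

  -- The 3-cycle in `R₁` and the size of `R₂`.

  -- Failing candidates give a chain w₃ ▷ w₂ ▷ w₁ in R ∩ N⁻(a), so a is a fourth vertex of R.
  winner : ∀ {R a x} → RetentiveIn ⊤ R → ∣ R ∣ ≤ 3 → a ∈ R → x ▷ a →
    ¬ ¬ ∃ λ w → w ∈ R × w ▷ a × (∀ {x} → x ▷ a → ¬ x ▷ w)
  winner {R} {a} {x} ret R≤3 a∈R x▷a none =
    descend ret a∈R (x , ∈-N⁻⁺ ∈⊤ x▷a) λ (C , C⊆R , retC) →
      let ▷a : ∀ {u} → u ∈ C → u ▷ a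
          ▷a u∈C = proj₂ (∈-N⁻⁻ ⊤ (⊆B retC u∈C))
      in case nonempty retC of λ (w₁ , w₁∈C) →
      none (w₁ , C⊆R w₁∈C , ▷a w₁∈C , λ y▷a y▷w₁ →
      case predecessor retC w₁∈C (∈-N⁻⁺ ∈⊤ y▷a) y▷w₁ of λ (w₂ , w₂∈C , w₂▷w₁ , _) →
      none (w₂ , C⊆R w₂∈C , ▷a w₂∈C , λ z▷a z▷w₂ →
      case predecessor retC w₂∈C (∈-N⁻⁺ ∈⊤ z▷a) z▷w₂ of λ (w₃ , w₃∈C , w₃▷w₂ , _) →
      <⇒≱ (s≤s R≤3) (length≤∣ R ∣
           ((▷⇒≢ w₃▷w₂ ∷ ▷-separates w₃▷w₂ w₂▷w₁ ∷ ▷⇒≢ (▷a w₃∈C) ∷ [])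
             ∷ (▷⇒≢ w₂▷w₁ ∷ ▷⇒≢ (▷a w₂∈C) ∷ []) ∷ (▷⇒≢ (▷a w₁∈C) ∷ []) ∷ [] ∷ [])
           (C⊆R w₃∈C ∷ C⊆R w₂∈C ∷ C⊆R w₁∈C ∷ a∈R ∷ []))))

  13≤∣R₂∣ : ∀ {R₁ R₂} → RetentiveIn ⊤ R₁ → RetentiveIn ⊤ R₂ → (∀ {x} → x ∈ R₁ → x ∉ R₂) →
    ∣ R₁ ∣ ≤ 3 → 13 ≤ ∣ R₂ ∣
  13≤∣R₂∣ {R₁} {R₂} ret₁ ret₂ disjoint R₁≤3 = decidable-stable (13 ≤? ∣ R₂ ∣) λ 13≰ →
    case nonempty ret₁ of λ (a₀ , a₀∈) →
    win a₀∈ λ (a₁ , a₁∈ , a₁▷a₀ , max₁) →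
    win a₁∈ λ (a₂ , a₂∈ , a₂▷a₁ , max₂) →
    win a₂∈ λ (a₃ , a₃∈ , a₃▷a₂ , max₃) →
    13≰ (cycle a₀∈ a₁∈ a₂∈ max₁ max₂ (closes a₀∈ a₁∈ a₂∈ a₃∈ a₁▷a₀ a₂▷a₁ a₃▷a₂ max₁ max₂ max₃))
    where
    win : ∀ {a} → a ∈ R₁ → ¬ ¬ ∃ λ w → w ∈ R₁ × w ▷ a × (∀ {x} → x ▷ a → ¬ x ▷ w)
    win a∈R₁ with dominating ret₂ ∈⊤
    ... | x , x∈R₂ , inj₁ refl = contradiction x∈R₂ (disjoint a∈R₁)
    ... | x , x∈R₂ , inj₂ x▷a  = winner ret₁ R₁≤3 a∈R₁ x▷a

    -- Were `a₃` different from `a₀`, all four vertices would be distinct, too many for `R₁`. Hence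
    -- `a₃` is `a₀`, and `max₃` is the claim.
    closes : ∀ {a₀ a₁ a₂ a₃} → a₀ ∈ R₁ → a₁ ∈ R₁ → a₂ ∈ R₁ → a₃ ∈ R₁ →
      a₁ ▷ a₀ → a₂ ▷ a₁ → a₃ ▷ a₂ →
      (∀ {x} → x ▷ a₀ → ¬ x ▷ a₁) → (∀ {x} → x ▷ a₁ → ¬ x ▷ a₂) → (∀ {x} → x ▷ a₂ → ¬ x ▷ a₃) →
      ∀ {x} → x ▷ a₂ → ¬ x ▷ a₀
    closes {a₀} {a₃ = a₃} a₀∈ a₁∈ a₂∈ a₃∈ a₁▷a₀ a₂▷a₁ a₃▷a₂ max₁ max₂ max₃ with a₃ ≟ a₀
    ... | yes refl = max₃
    ... | no a₃≢a₀ = contradiction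
      (length≤∣ R₁ ∣
        ((▷⇒≢ a₃▷a₂ ∷ ▷-separates a₃▷a₂ a₂▷a₁ ∷ a₃≢a₀ ∷ [])
          ∷ (▷⇒≢ a₂▷a₁ ∷ ▷-separates a₂▷a₁ a₁▷a₀ ∷ []) ∷ (▷⇒≢ a₁▷a₀ ∷ []) ∷ [] ∷ [])
        (a₃∈ ∷ a₂∈ ∷ a₁∈ ∷ a₀∈ ∷ []))
      (<⇒≱ (s≤s R₁≤3))

    -- A retentive `C` in the in-neighbourhood of `v` can be taken inside `R₂`, so it avoids `a` and
    -- `b`; its six members all count towards the indegree.
    indegree : ∀ {v a b} → v ∈ R₂ → a ∈ R₁ → b ∈ R₁ → a ▷ v → b ▷ v →
      (∀ {x} → x ▷ a → ¬ x ▷ b) → 6 ≤ ∣ N⁻ R₂ v ∣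
    indegree {v} {a} {b} v∈R₂ a∈R₁ b∈R₁ a▷v b▷v ¬both = decidable-stable (6 ≤? _) λ 6≰ →
      descend ret₂ v∈R₂ (a , ∈-N⁻⁺ ∈⊤ a▷v) λ (C , C⊆R₂ , retC) → 6≰ (≤-trans
        (6≤∣C∣ retC (∈-N⁻⁺ ∈⊤ a▷v) (∈-N⁻⁺ ∈⊤ b▷v)
          (disjoint a∈R₁ ∘ C⊆R₂) (disjoint b∈R₁ ∘ C⊆R₂) (λ _ (u▷a , u▷b) → ¬both u▷a u▷b))
        (p⊆q⇒∣p∣≤∣q∣ λ u∈C → ∈-N⁻⁺ (C⊆R₂ u∈C) (proj₂ (∈-N⁻⁻ ⊤ (⊆B retC u∈C)))))

    cycle : ∀ {a₀ a₁ a₂} → a₀ ∈ R₁ → a₁ ∈ R₁ → a₂ ∈ R₁ →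
      (∀ {x} → x ▷ a₀ → ¬ x ▷ a₁) → (∀ {x} → x ▷ a₁ → ¬ x ▷ a₂) → (∀ {x} → x ▷ a₂ → ¬ x ▷ a₀) →
      13 ≤ ∣ R₂ ∣
    cycle {a₀} {a₁} {a₂} a₀∈ a₁∈ a₂∈ max₁ max₂ max₃ = 2*min-indegree<∣R∣ (nonempty ret₂) in≥6
      where
      beaten : ∀ {v a} → v ∈ R₂ → a ∈ R₁ → ¬ v ▷ a → a ▷ v
      beaten v∈R₂ a∈R₁ = ⋫⇒▷ λ { refl → disjoint a∈R₁ v∈R₂ }

      in≥6 : ∀ {v} → v ∈ R₂ → 6 ≤ ∣ N⁻ R₂ v ∣
      -- No vertex beats two members of the cycle, so two of them beat `v`; each branch selects such
      -- a pair.
      in≥6 {v} v∈ with v ▷? a₀ | v ▷? a₁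
      ... | yes v▷a₀ | _        = indegree v∈ a₁∈ a₂∈ (beaten v∈ a₁∈ (max₁ v▷a₀))
        (beaten v∈ a₂∈ (λ v▷a₂ → max₃ v▷a₂ v▷a₀)) max₂
      ... | no ¬v▷a₀ | yes v▷a₁ = indegree v∈ a₂∈ a₀∈ (beaten v∈ a₂∈ (max₂ v▷a₁))
        (beaten v∈ a₀∈ ¬v▷a₀) max₃
      ... | no ¬v▷a₀ | no ¬v▷a₁ = indegree v∈ a₀∈ a₁∈ (beaten v∈ a₀∈ ¬v▷a₀)
        (beaten v∈ a₁∈ ¬v▷a₁) max₁

  -- Disjointness of minimal retentive sets, and the conclusion.

  -- A nonempty intersection would itself be retentive, so by minimality it would equal both sets.
  minimal-disjoint : ∀ {R₁ R₂} → MinimalTauRetentive Tr R₁ → MinimalTauRetentive Tr R₂ → R₁ ≢ R₂ →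
    ∀ {x} → x ∈ R₁ → x ∉ R₂
  minimal-disjoint {R₁} {R₂} ((_ , _ , closed₁) , min₁) ((_ , _ , closed₂) , min₂) R₁≢R₂ {x} x∈R₁ x∈R₂ =
    R₁≢R₂ (⊆-antisym (p∩q⊆q R₁ R₂ ∘ ⊆∩ (p∩q⊆p R₁ R₂) min₁) (p∩q⊆p R₁ R₂ ∘ ⊆∩ (p∩q⊆q R₁ R₂) min₂))
    where
    ret∩ : Retentive Tr (inTau Tr n) ⊤ (R₁ ∩ R₂)
    ret∩ = (x , x∈p∩q⁺ (x∈R₁ , x∈R₂)) , (λ _ → ∈⊤) , λ v v∈ ne y y∈τ →
      x∈p∩q⁺ (closed₁ v (p∩q⊆p R₁ R₂ v∈) ne y y∈τ , closed₂ v (p∩q⊆q R₁ R₂ v∈) ne y y∈τ)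

    ⊆∩ : ∀ {R} → R₁ ∩ R₂ ⊆ R → (∀ A → Retentive Tr (inTau Tr n) ⊤ A → ¬ A ⊂ R) → R ⊆ R₁ ∩ R₂
    ⊆∩ ∩⊆R min {y} y∈R =
      decidable-stable (y ∈? _) λ y∉∩ → min _ ret∩ (∩⊆R , y , y∈R , y∉∩)

theorem4 : (k : ℕ) → 1 ≤ k → k ≤ 12 →
    (n : ℕ) (Tr : Tournament n) (R₁ R₂ : Subset n) →
    MinimalTauRetentive Tr R₁ → MinimalTauRetentive Tr R₂ → R₁ ≢ R₂ →
    ∣ R₁ ∣ ≡ 3 → ∣ R₂ ∣ ≡ k → ⊥
theorem4 k 1≤k k≤12 n Tr R₁ R₂ min₁ min₂ R₁≢R₂ ∣R₁∣≡3 refl =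
  <⇒≱ (s≤s k≤12) (13≤∣R₂∣ Tr (ret min₁) (ret min₂) (minimal-disjoint Tr min₁ min₂ R₁≢R₂) (≤-reflexive ∣R₁∣≡3))
  where
  ret : ∀ {R} → MinimalTauRetentive Tr R → RetentiveIn Tr ⊤ R
  ret (retR , _) = retentiveIn (≤-trans (∣p∣≤n ⊤) (m≤n⇒m≤1+n ≤-refl)) retR
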